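{- Let $n\ge 1$ and let $s=a_1a_2\cdots a_n$ be a permutation of $[n]$ in one-line form. Then $$bid(s)\geq \frac{\max_{\gamma}\{|C(p_t\bar{s} \gamma)-C(\gamma)|\}}{2},$$ where $\gamma$ ranges over all permutations of $[n]^*=\{0,1,\dots,n\}$.
   Context: $[n]=\{1,\dots,n\}$. A block-interchange on a sequence $a_1\cdots a_n$ swaps two disjoint, not necessarily adjacent, blocks: for some $1\le i\le j<k\le l\le n$ it changes the sequence into $a_1\cdots a_{i-1}\,a_k\cdots a_l\,a_{j+1}\cdots a_{k-1}\,a_i\cdots a_j\,a_{l+1}\cdots a_n$. The block-interchange distance $bid(s)$ is the minimum number of block-interchanges needed to transform $s$ into $e_n=12\cdots n$. In cycle notation on $[n]^*$, $\bar s=(0~a_1~a_2~\cdots~a_n)$ and $p_t=(n~n-1~\cdots~1~0)$. $C(\pi)$ denotes the number of cycles of a permutation $\pi$ (fixed points included). Products of permutations are compositions of maps (right to left). -}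

module Defs where

open import Data.Fin.Base using (Fin; zero; suc; toℕ; fromℕ; fromℕ<; inject₁; punchIn)
open import Data.Fin.Permutation
  using (Permutation′; _⟨$⟩ʳ_; _⟨$⟩ˡ_; _∘ₚ_; _≈_; id; flip; reverse; lift₀; insert; remove;
         inverseˡ; inverseʳ; insert-punchIn; insert-remove)
import Data.Fin.Properties as Fin
open import Data.List.Base
  using (List; []; _∷_; [_]; _++_; map; tabulate; allFin; length; filter; deduplicate; cartesianProductWith)
open import Data.List.Extrema.Nat using (max; v≤max⁺; argmax-sel)
open import Data.List.Membership.Propositional using (_∈_)
open import Data.List.Membership.Propositional.Properties
  using (∈-allFin; ∈-tabulate⁺; ∈-cartesianProductWith⁺; ∈-map⁺; ∈-map⁻)
open import Data.List.Membership.Propositional.Properties.WithK using (unique∧set⇒bag)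
open import Data.List.Properties using (filter-≐; ≡-dec)
open import Data.List.Relation.Binary.BagAndSetEquality using (∼bag⇒↭)
open import Data.List.Relation.Binary.Permutation.Propositional using (_↭_; refl; prep; swap; trans)
open import Data.List.Relation.Unary.Any using (here)
import Data.List.Relation.Unary.Any as Any
open import Data.List.Relation.Unary.Unique.Propositional.Properties using (tabulate⁺; allFin⁺)
open import Data.Nat.Base
open import Data.Nat.DivMod using (m≡m%n+[m/n]*n; m%n<n)
open import Data.Nat.GeneralisedArithmetic using (fold; fold-+)
import Data.Nat.Properties as ℕ
open import Data.Product.Base using (∃; ∃₂; _×_; _,_; proj₁; proj₂)
open import Data.Sum.Base using (inj₁; inj₂)
open import Function.Base using (_∘_)
open import Function.Bundles using (mk⇔)
open import Relation.Binary.Definitions using (Decidable; DecidableEquality)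
open import Relation.Binary.PropositionalEquality as ≡
  using (_≡_; cong; sym; subst; module ≡-Reasoning)
open import Relation.Nullary using (Dec; yes; no; contradiction)
open import Relation.Nullary.Decidable using (map′; ¬?)

private
  variable
    n : ℕ
    A : Set

IsLeast : (ℕ → Set) → ℕ → Set
IsLeast P d = P d × (∀ e → P e → d ≤ e)

least : {P : ℕ → Set} → (∀ d → Dec (P d)) → ∀ b → P b → ∃ (IsLeast P)
least P? zero    p = 0 , p , λ _ _ → z≤n
least {P} P? (suc b) p with P? 0
... | yes p₀ = 0 , p₀ , λ _ _ → z≤n
... | no ¬p₀ with least {P ∘ suc} (P? ∘ suc) b p
...   | d , pd , d≤ = suc d , pd , λ where
          zero    p₀ → contradiction p₀ ¬p₀
          (suc e) pe → s≤s (d≤ e pe)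

-- Here  pre = a₁ ⋯ a_{i-1},  a ∷ as = aᵢ ⋯ aⱼ,  mid = a_{j+1} ⋯ a_{k-1},
-- b ∷ bs = a_k ⋯ a_l  and  post = a_{l+1} ⋯ aₙ;  only the two swapped
-- blocks are required to be nonempty.
data BlockInterchange {A : Set} : List A → List A → Set where
  interchange : ∀ pre a as mid b bs post →
    BlockInterchange (pre ++ (a ∷ as) ++ mid ++ (b ∷ bs) ++ post)
                     (pre ++ (b ∷ bs) ++ mid ++ (a ∷ as) ++ post)

infix 4 _⟶[_]_

data _⟶[_]_ {A : Set} : List A → ℕ → List A → Set where
  done : ∀ {xs} → xs ⟶[ 0 ] xs
  step : ∀ {xs ys zs d} → BlockInterchange xs ys → ys ⟶[ d ] zs → xs ⟶[ suc d ] zs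

private
  split? : {P : List A → List A → Set} → (∀ ps qs → Dec (P ps qs)) →
           ∀ xs → Dec (∃₂ λ ps qs → xs ≡ ps ++ qs × P ps qs)
  split? P? [] = map′ (λ p → [] , [] , ≡.refl , p)
                      (λ { ([] , [] , _ , p) → p }) (P? [] [])
  split? P? (x ∷ xs) with P? [] (x ∷ xs) | split? (P? ∘ (x ∷_)) xs
  ... | yes p | _ = yes ([] , x ∷ xs , ≡.refl , p)
  ... | no _  | yes (ps , qs , e , p) = yes (x ∷ ps , qs , cong (x ∷_) e , p)
  ... | no ¬p | no ¬q = no λ where
    ([] , _ , ≡.refl , p) → ¬p p
    (_ ∷ ps , qs , ≡.refl , p) → ¬q (ps , qs , ≡.refl , p)

  split⁺? : {P : A → List A → List A → Set} → (∀ a as qs → Dec (P a as qs)) →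
            ∀ xs → Dec (∃ λ a → ∃₂ λ as qs → xs ≡ (a ∷ as) ++ qs × P a as qs)
  split⁺? P? [] = no λ { (_ , _ , _ , () , _) }
  split⁺? P? (x ∷ xs) =
    map′ (λ { (as , qs , e , p) → x , as , qs , cong (x ∷_) e , p })
         (λ { (_ , as , qs , ≡.refl , p) → as , qs , ≡.refl , p })
         (split? (P? x) xs)

⟶? : DecidableEquality A → ∀ d (xs zs : List A) → Dec (xs ⟶[ d ] zs)
⟶? _≟_ zero xs zs = map′ (λ { ≡.refl → done }) (λ { done → ≡.refl }) (≡-dec _≟_ xs zs)
⟶? _≟_ (suc d) xs zs = map′
  (λ { (pre , _ , ≡.refl , a , as , _ , ≡.refl , mid , _ , ≡.refl , b , bs , post , ≡.refl , r) →
       step (interchange pre a as mid b bs post) r })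
  (λ { (step (interchange pre a as mid b bs post) r) →
       pre , _ , ≡.refl , a , as , _ , ≡.refl , mid , _ , ≡.refl , b , bs , post , ≡.refl , r })
  (split? (λ pre ys → split⁺? (λ a as ys → split? (λ mid ys → split⁺? (λ b bs post →
     ⟶? _≟_ d (pre ++ (b ∷ bs) ++ mid ++ (a ∷ as) ++ post) zs) ys) ys) ys) xs)

private
  ⟶-cons : ∀ {x : A} {d xs ys} → xs ⟶[ d ] ys → x ∷ xs ⟶[ d ] x ∷ ys
  ⟶-cons done = done
  ⟶-cons {x = x} (step (interchange pre a as mid b bs post) r) =
    step (interchange (x ∷ pre) a as mid b bs post) (⟶-cons r)

  ⟶-trans : ∀ {d e} {xs ys zs : List A} → xs ⟶[ d ] ys → ys ⟶[ e ] zs → xs ⟶[ d + e ] zs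
  ⟶-trans done       r = r
  ⟶-trans (step s q) r = step s (⟶-trans q r)

↭⇒⟶ : {xs ys : List A} → xs ↭ ys → ∃ λ d → xs ⟶[ d ] ys
↭⇒⟶ refl        = 0 , done
↭⇒⟶ (prep x p)  = proj₁ (↭⇒⟶ p) , ⟶-cons (proj₂ (↭⇒⟶ p))
↭⇒⟶ (swap {xs = xs} x y p) =
  _ , step (interchange [] x [] [] y [] xs) (⟶-cons (⟶-cons (proj₂ (↭⇒⟶ p))))
↭⇒⟶ (trans p q) = _ , ⟶-trans (proj₂ (↭⇒⟶ p)) (proj₂ (↭⇒⟶ q))

-- The element i of Fin n stands for the element toℕ i + 1 of [n], so
-- that suc : Fin n → Fin (suc n) is the inclusion of [n] into [n]*.

oneLine : Permutation′ n → List (Fin n)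
oneLine s = tabulate (s ⟨$⟩ʳ_)

e : ∀ n → List (Fin n)
e = allFin

oneLine-↭ : (s : Permutation′ n) → oneLine s ↭ e n
oneLine-↭ {n} s = ∼bag⇒↭ (unique∧set⇒bag (tabulate⁺ inj) (allFin⁺ n)
  (mk⇔ (λ _ → ∈-allFin _)
       (λ _ → subst (_∈ oneLine s) (inverseʳ s) (∈-tabulate⁺ {f = s ⟨$⟩ʳ_} (s ⟨$⟩ˡ _)))))
  where
  inj : ∀ {i j} → s ⟨$⟩ʳ i ≡ s ⟨$⟩ʳ j → i ≡ j
  inj eq = ≡.trans (sym (inverseˡ s)) (≡.trans (cong (s ⟨$⟩ˡ_) eq) (inverseˡ s))

bid-least : (s : Permutation′ n) → ∃ (IsLeast (λ d → oneLine s ⟶[ d ] e n))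
bid-least s = least (λ d → ⟶? Fin._≟_ d (oneLine s) (e _))
                    (proj₁ sortable) (proj₂ sortable)
  where sortable = ↭⇒⟶ (oneLine-↭ s)

bid : Permutation′ n → ℕ
bid s = proj₁ (bid-least s)

infixl 7 _·_

-- _∘ₚ_ applies its left argument first; _·_ applies its right one first.
_·_ : Permutation′ n → Permutation′ n → Permutation′ n
π · ρ = ρ ∘ₚ π

-- 0 ↦ 1 ↦ ⋯ ↦ n ↦ 0
rotate : ∀ n → Permutation′ (suc n)
rotate n = insert (fromℕ n) zero id

-- The cycle (c₀ c₁ ⋯ cₙ), for an arrangement c₀, …, cₙ of all of [n]*.
cycle : Permutation′ (suc n) → Permutation′ (suc n)
cycle c = c · rotate _ · flip c

private
  punchIn-fromℕ : (i : Fin n) → punchIn (fromℕ n) i ≡ inject₁ i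
  punchIn-fromℕ zero    = ≡.refl
  punchIn-fromℕ (suc i) = cong suc (punchIn-fromℕ i)

  rotate-suc : (i : Fin n) → rotate n ⟨$⟩ʳ inject₁ i ≡ suc i
  rotate-suc {n} i = ≡.trans (cong (rotate n ⟨$⟩ʳ_) (sym (punchIn-fromℕ i)))
                             (insert-punchIn (fromℕ n) zero id i)

  rotate-last : ∀ n → rotate n ⟨$⟩ʳ fromℕ n ≡ zero
  rotate-last n with fromℕ n Fin.≟ fromℕ n
  ... | yes _ = ≡.refl
  ... | no ¬p = contradiction ≡.refl ¬p

cycle-suc : (c : Permutation′ (suc n)) (i : Fin n) →
            cycle c ⟨$⟩ʳ (c ⟨$⟩ʳ inject₁ i) ≡ c ⟨$⟩ʳ suc i
cycle-suc c i = cong (c ⟨$⟩ʳ_) (≡.trans (cong (rotate _ ⟨$⟩ʳ_) (inverseˡ c)) (rotate-suc i))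

cycle-last : (c : Permutation′ (suc n)) → cycle c ⟨$⟩ʳ (c ⟨$⟩ʳ fromℕ n) ≡ c ⟨$⟩ʳ zero
cycle-last c = cong (c ⟨$⟩ʳ_) (≡.trans (cong (rotate _ ⟨$⟩ʳ_) (inverseˡ c)) (rotate-last _))

-- (0 a₁ a₂ ⋯ aₙ)
bar : Permutation′ n → Permutation′ (suc n)
bar s = cycle (lift₀ s)

-- (n n-1 ⋯ 1 0)
pₜ : ∀ n → Permutation′ (suc n)
pₜ n = cycle reverse

SameCycle : Permutation′ n → Fin n → Fin n → Set
SameCycle π i j = ∃ λ k → fold i (π ⟨$⟩ʳ_) k ≡ j

private
  fold-injective : (π : Permutation′ n) → ∀ k {i j} →
                   fold i (π ⟨$⟩ʳ_) k ≡ fold j (π ⟨$⟩ʳ_) k → i ≡ j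
  fold-injective π zero    eq = eq
  fold-injective π (suc k) eq = fold-injective π k
    (≡.trans (sym (inverseˡ π)) (≡.trans (cong (π ⟨$⟩ˡ_) eq) (inverseˡ π)))

  period : (π : Permutation′ n) (i : Fin n) →
           ∃ λ p → p < n × fold i (π ⟨$⟩ʳ_) (suc p) ≡ i
  period {n} π i with Fin.pigeonhole (ℕ.n<1+n n) (λ k → fold i (π ⟨$⟩ʳ_) (toℕ k))
  ... | a , b , a<b , eq with ℕ.m≤n⇒∃[o]m+o≡n a<b
  ...   | p , 1+a+p≡b = p , p<n , sym (fold-injective π (toℕ a)
            (≡.trans eq (≡.trans (cong (fold i (π ⟨$⟩ʳ_)) b≡) (fold-+ i (π ⟨$⟩ʳ_) (toℕ a)))))
    where
    b≡ : toℕ b ≡ toℕ a + suc p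
    b≡ = ≡.trans (sym 1+a+p≡b) (sym (ℕ.+-suc (toℕ a) p))
    p<n : p < n
    p<n = ℕ.≤-trans (ℕ.≤-trans (ℕ.m≤n+m (suc p) (toℕ a)) (ℕ.≤-reflexive (sym b≡)))
                    (Fin.toℕ≤pred[n] b)

  fold-period : (π : Permutation′ n) (i : Fin n) → ∀ p → fold i (π ⟨$⟩ʳ_) p ≡ i →
                ∀ q → fold i (π ⟨$⟩ʳ_) (q * p) ≡ i
  fold-period π i p eq zero    = ≡.refl
  fold-period π i p eq (suc q) = ≡.trans (fold-+ i (π ⟨$⟩ʳ_) p)
    (≡.trans (cong (λ x → fold x (π ⟨$⟩ʳ_) p) (fold-period π i p eq q)) eq)

  reduce : (π : Permutation′ n) (i : Fin n) → ∀ k →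
           ∃ λ (k′ : Fin n) → fold i (π ⟨$⟩ʳ_) (toℕ k′) ≡ fold i (π ⟨$⟩ʳ_) k
  reduce {n} π i k with period π i
  ... | p , p<n , eq = fromℕ< r<n , ≡.trans (cong f (Fin.toℕ-fromℕ< r<n)) (sym (begin
      f k                                   ≡⟨ cong f (m≡m%n+[m/n]*n k (suc p)) ⟩
      f (k % suc p + k / suc p * suc p)     ≡⟨ fold-+ i (π ⟨$⟩ʳ_) (k % suc p) ⟩
      fold (f (k / suc p * suc p)) (π ⟨$⟩ʳ_) (k % suc p)
        ≡⟨ cong (λ x → fold x (π ⟨$⟩ʳ_) (k % suc p)) (fold-period π i (suc p) eq (k / suc p)) ⟩
      f (k % suc p) ∎))
    where
    open ≡-Reasoning
    f = fold i (π ⟨$⟩ʳ_)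
    r<n : k % suc p < n
    r<n = ℕ.<-≤-trans (m%n<n k (suc p)) p<n

SameCycle? : (π : Permutation′ n) → Decidable (SameCycle π)
SameCycle? π i j =
  map′ (λ { (k , eq) → toℕ k , eq })
       (λ { (k , eq) → proj₁ (reduce π i k) , ≡.trans (proj₂ (reduce π i k)) eq })
       (Fin.any? (λ k → fold i (π ⟨$⟩ʳ_) (toℕ k) Fin.≟ j))

-- One representative is kept from each class of SameCycle, so fixed
-- points count as cycles.
C : Permutation′ n → ℕ
C {n} π = length (deduplicate (SameCycle? π) (allFin n))

private
  SameCycle-cong : {π ρ : Permutation′ n} → π ≈ ρ → ∀ {i j} → SameCycle π i j → SameCycle ρ i j
  SameCycle-cong {π = π} {ρ} π≈ρ {i} (k , eq) = k , ≡.trans (sym (go k)) eq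
    where
    go : ∀ k → fold i (π ⟨$⟩ʳ_) k ≡ fold i (ρ ⟨$⟩ʳ_) k
    go zero    = ≡.refl
    go (suc k) = ≡.trans (π≈ρ _) (cong (ρ ⟨$⟩ʳ_) (go k))

C-cong : {π ρ : Permutation′ n} → π ≈ ρ → C π ≡ C ρ
C-cong {n} {π} {ρ} π≈ρ = cong length (go (allFin n))
  where
  go : ∀ xs → deduplicate (SameCycle? π) xs ≡ deduplicate (SameCycle? ρ) xs
  go []       = ≡.refl
  go (x ∷ xs) = cong (x ∷_) (≡.trans
    (filter-≐ (¬? ∘ SameCycle? π x) (¬? ∘ SameCycle? ρ x)
       ( (λ ¬p q → ¬p (SameCycle-cong {π = ρ} {π} (sym ∘ π≈ρ) q))
       , (λ ¬p q → ¬p (SameCycle-cong {π = π} {ρ} π≈ρ q)))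
       (deduplicate (SameCycle? π) xs))
    (cong (filter (¬? ∘ SameCycle? ρ x)) (go xs)))

-- Complete only up to _≈_ (equality of the underlying maps), which C
-- respects.
permutations : ∀ n → List (Permutation′ n)
permutations zero    = [ id ]
permutations (suc n) = cartesianProductWith (insert zero) (allFin (suc n)) (permutations n)

private
  insert-cong : ∀ j {π ρ : Permutation′ n} → π ≈ ρ → insert zero j π ≈ insert zero j ρ
  insert-cong j π≈ρ zero    = ≡.refl
  insert-cong j π≈ρ (suc k) = cong (punchIn j) (π≈ρ k)

permutations-complete : (π : Permutation′ n) → ∃ λ ρ → ρ ∈ permutations n × ρ ≈ π
permutations-complete {zero}  π = id , here ≡.refl , λ ()
permutations-complete {suc n} π with permutations-complete (remove zero π)
... | ρ , ρ∈ , ρ≈ = insert zero (π ⟨$⟩ʳ zero) ρ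
                  , ∈-cartesianProductWith⁺ (insert zero) (∈-allFin _) ρ∈
                  , λ i → ≡.trans (insert-cong (π ⟨$⟩ʳ zero) {ρ} {remove zero π} ρ≈ i)
                                  (insert-remove zero π i)

-- The bottom value 0 of max is immaterial: see maxₚ-upper and
-- maxₚ-attained.
maxₚ : (Permutation′ n → ℕ) → ℕ
maxₚ {n} f = max 0 (map f (permutations n))

maxₚ-upper : (f : Permutation′ n → ℕ) → (∀ {π ρ} → π ≈ ρ → f π ≡ f ρ) →
             ∀ π → f π ≤ maxₚ f
maxₚ-upper f f-cong π with permutations-complete π
... | ρ , ρ∈ , ρ≈π = v≤max⁺ 0 _
  (inj₂ (Any.map (λ fρ≡x → ℕ.≤-reflexive (≡.trans (sym (f-cong {ρ} {π} ρ≈π)) fρ≡x)) (∈-map⁺ f ρ∈)))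

maxₚ-attained : (f : Permutation′ n → ℕ) → (∀ {π ρ} → π ≈ ρ → f π ≡ f ρ) →
                ∃ λ π → f π ≡ maxₚ f
maxₚ-attained {n} f f-cong with argmax-sel (λ x → x) 0 (map f (permutations n))
... | inj₁ max≡0 = id , ≡.trans (ℕ.n≤0⇒n≡0 (subst (f id ≤_) max≡0 (maxₚ-upper f f-cong id))) (sym max≡0)
... | inj₂ max∈ with ∈-map⁻ f max∈
...   | π , _ , eq = π , sym eq

{-# OPTIONS --safe #-}

-- Write σ for pₜ.  The edges (x , s̄ x) of the cycle s̄ are the pairs of
-- consecutive entries of 0 a₁ ⋯ aₙ 0, and a block-interchange amounts to
-- exchanging the targets of two edges, twice.  Such an exchange replaces the
-- permutation π by π τ with a transposition τ, which changes C (σ π γ) by at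
-- most 1, whatever γ is.  After d block-interchanges s̄ has become the cycle
-- (0 1 ⋯ n) = σ⁻¹, so that C (σ s̄ γ) and C γ differ by at most 2 d.
module Submission where

open import Defs
open import Data.Fin.Base using (Fin; zero; suc; toℕ; fromℕ; inject₁; opposite)
open import Data.Fin.Permutation
  using (Permutation′; _⟨$⟩ʳ_; _⟨$⟩ˡ_; reverse; lift₀; transpose; inverseˡ; inverseʳ)
import Data.Fin.Permutation.Components as PC
import Data.Fin.Base as Fin
import Data.Fin.Properties as Fin
open import Data.Integer.Base using (+_)
import Data.Integer.Base as ℤ
import Data.Integer.Properties as ℤ
open import Data.List.Base
  using (List; []; _∷_; [_]; _++_; map; tabulate; allFin; length; lookup; filter; deduplicate)
open import Data.List.Extrema.Nat using (max≤v⁺)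
open import Data.List.Membership.Propositional.Properties using (∈-allFin; ∈-lookup)
open import Data.List.Properties using (filter-all)
open import Data.List.Relation.Binary.Permutation.Propositional
  using (_↭_; ↭-refl; ↭⇒↭ₛ)
open import Data.List.Relation.Binary.Permutation.Propositional.Properties
  using (All-resp-↭; ++-commutativeMonoid)
  renaming (map⁺ to ↭-map⁺)
import Data.List.Relation.Binary.Permutation.Setoid.Properties as Permutationₛ
open import Data.List.Relation.Unary.All as All using (All; []; _∷_)
import Data.List.Relation.Unary.All.Properties as All
open import Data.List.Relation.Unary.AllPairs using (AllPairs; []; _∷_)
import Data.List.Relation.Unary.AllPairs.Properties as AllPairs
open import Data.List.Relation.Unary.Any as Any using (Any)
import Data.List.Relation.Unary.Any.Properties as Any
open import Data.List.Relation.Unary.Unique.Propositional using (Unique)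
import Data.List.Relation.Unary.Unique.Propositional.Properties as Unique
open import Data.Nat.Base using (ℕ; zero; suc; _+_; _*_; _≤_; z≤n; s≤s; ∣_-_∣)
import Data.Nat.Base as ℕ
open import Data.Nat.GeneralisedArithmetic using (fold; fold-+)
import Data.Nat.Properties as ℕ
open import Data.Product.Base using (∃; _×_; _,_; proj₁; proj₂)
open import Data.Rational.Base using (_/_; _≥_)
import Data.Rational.Base as ℚ
import Data.Rational.Properties as ℚ
import Data.Rational.Unnormalised.Base as ℚᵘ
import Data.Rational.Unnormalised.Properties as ℚᵘ
open import Data.Sum.Base using (_⊎_; inj₁; inj₂)
import Algebra.Solver.CommutativeMonoid as CommutativeMonoidSolver
open import Function.Base using (_∘_)
open import Relation.Binary.Core using (Rel)
open import Relation.Binary.Definitions using (Decidable; Reflexive; Symmetric; Transitive)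
open import Relation.Binary.PropositionalEquality
  using (_≡_; _≢_; refl; sym; trans; cong; subst; subst₂; setoid)
open import Relation.Nullary using (¬_; yes; no; contradiction)
open import Relation.Nullary.Decidable using (¬?)
open import Level using (0ℓ)

private
  variable
    n : ℕ
    A : Set

-- Counting cycles

lookup-apart : {R : Rel A 0ℓ} {xs : List A} → AllPairs (λ x y → ¬ R x y) xs →
               ∀ {i j} → i Fin.< j → ¬ R (lookup xs i) (lookup xs j)
lookup-apart (¬r ∷ _)  {zero}  {suc j} _         = All.lookup ¬r (∈-lookup j)
lookup-apart (_ ∷ ¬rs) {suc i} {suc j} (s≤s i<j) = lookup-apart ¬rs i<j

-- Pigeonhole: otherwise two entries of `xs` would be related to the same entry of `ys`, hence to
-- each other.
apart⇒length≤ : {R : Rel A 0ℓ} → Symmetric R → Transitive R →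
                {xs ys : List A} → AllPairs (λ x y → ¬ R x y) xs →
                (∀ x → Any (R x) ys) → length xs ≤ length ys
apart⇒length≤ {R = R} R-sym R-trans {xs} {ys} apart cover = ℕ.≮⇒≥ λ ys<xs →
  let i , j , i<j , eq = Fin.pigeonhole ys<xs (Any.index ∘ cover ∘ lookup xs)
  in lookup-apart apart i<j
       (R-trans (subst (R (lookup xs i) ∘ lookup ys) eq (Any.lookup-index (cover (lookup xs i))))
                (R-sym (Any.lookup-index (cover (lookup xs j)))))

-- The filter drops at most one entry, since two entries related to `a` would be related to each
-- other.
length≤1+filter : {R : Rel A 0ℓ} → Symmetric R → Transitive R → (R? : Decidable R) →
                  ∀ a {xs} → AllPairs (λ x y → ¬ R x y) xs →
                  length xs ≤ suc (length (filter (¬? ∘ R? a) xs))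
length≤1+filter R-sym R-trans R? a {[]} [] = z≤n
length≤1+filter R-sym R-trans R? a {x ∷ xs} (¬r ∷ ¬rs) with R? a x
... | no  _  = s≤s (length≤1+filter R-sym R-trans R? a ¬rs)
... | yes ax = s≤s (ℕ.≤-reflexive (cong length (sym (filter-all (¬? ∘ R? a)
                 (All.map (λ ¬xy ay → ¬xy (R-trans (R-sym ax) ay)) ¬r)))))

deduplicate-apart : {R : Rel A 0ℓ} (R? : Decidable R) → ∀ xs →
                    AllPairs (λ x y → ¬ R x y) (deduplicate R? xs)
deduplicate-apart R? []       = []
deduplicate-apart R? (x ∷ xs) = All.all-filter (¬? ∘ R? x) (deduplicate R? xs)
                              ∷ AllPairs.filter⁺ (¬? ∘ R? x) (deduplicate-apart R? xs)

⟨$⟩ʳ-injective : (π : Permutation′ n) → ∀ {i j} → π ⟨$⟩ʳ i ≡ π ⟨$⟩ʳ j → i ≡ j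
⟨$⟩ʳ-injective π eq = trans (sym (inverseˡ π)) (trans (cong (π ⟨$⟩ˡ_) eq) (inverseˡ π))

module _ (π : Permutation′ n) where

  private
    f = π ⟨$⟩ʳ_

  SameCycle-refl : Reflexive (SameCycle π)
  SameCycle-refl = 0 , refl

  SameCycle-trans : Transitive (SameCycle π)
  SameCycle-trans {i} (k , refl) (l , refl) = l + k , fold-+ i f l

  SameCycle-step : ∀ i → SameCycle π i (f i)
  SameCycle-step i = 1 , refl

  -- `SameCycle` only iterates forwards, so a backward step has to go round the cycle. Two iterates
  -- of `i` coincide by the pigeonhole principle, and injectivity cancels common steps until the
  -- earlier one is `i` itself.
  SameCycle-step⁻ : ∀ i → SameCycle π (f i) i
  SameCycle-step⁻ i =
    let a , b , a<b , eq = Fin.pigeonhole (ℕ.n<1+n n) (fold i f ∘ toℕ)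
    in return (toℕ a) (toℕ b) a<b eq
    where
    return : ∀ a b → a ℕ.< b → fold i f a ≡ fold i f b → SameCycle π (f i) i
    return zero    (suc b) _         eq =
      b , trans (sym (fold-+ i f b)) (trans (cong (fold i f) (ℕ.+-comm b 1)) (sym eq))
    return (suc a) (suc b) (s≤s a<b) eq = return a b a<b (⟨$⟩ʳ-injective π eq)

  SameCycle-sym : Symmetric (SameCycle π)
  SameCycle-sym {i} (k , refl) = back k
    where
    back : ∀ k → SameCycle π (fold i f k) i
    back zero    = SameCycle-refl
    back (suc k) = SameCycle-trans (SameCycle-step⁻ (fold i f k)) (back k)

  representatives : List (Fin n)
  representatives = deduplicate (SameCycle? π) (allFin n)

  representatives-apart : AllPairs (λ i j → ¬ SameCycle π i j) representatives
  representatives-apart = deduplicate-apart (SameCycle? π) (allFin n)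

  representatives-cover : ∀ i → Any (SameCycle π i) representatives
  representatives-cover i = Any.deduplicate⁺ (SameCycle? π)
    (λ yx xi → SameCycle-trans xi (SameCycle-sym yx))
    (Any.map (λ { refl → SameCycle-refl }) (∈-allFin i))

-- Multiplication by a transposition

transpose-first : (a b : Fin n) → PC.transpose a b a ≡ b
transpose-first a b with a Fin.≟ a
... | yes _  = refl
... | no a≢a = contradiction refl a≢a

transpose-second : (a b : Fin n) → PC.transpose a b b ≡ a
transpose-second a b with b Fin.≟ a
... | yes b≡a = b≡a
... | no _ with b Fin.≟ b
...   | yes _  = refl
...   | no b≢b = contradiction refl b≢b

transpose-other : {a b x : Fin n} → a ≢ x → b ≢ x → PC.transpose a b x ≡ x
transpose-other {a = a} {b} {x} a≢x b≢x with x Fin.≟ a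
... | yes refl = contradiction refl a≢x
... | no _ with x Fin.≟ b
...   | yes refl = contradiction refl b≢x
...   | no _     = refl

transpose-involutive : (a b x : Fin n) → PC.transpose a b (PC.transpose a b x) ≡ x
transpose-involutive a b x with x Fin.≟ a
... | yes refl = transpose-second a b
... | no x≢a with x Fin.≟ b
...   | yes refl = transpose-first a b
...   | no x≢b   = transpose-other (x≢a ∘ sym) (x≢b ∘ sym)

module _ (π γ : Permutation′ n) (a b : Fin n) where

  private
    π′ = π · γ
    ρ′ = π · transpose a b · γ
    a′ = γ ⟨$⟩ˡ a
    b′ = γ ⟨$⟩ˡ b

    Touches : Fin n → Set
    Touches i = SameCycle π′ i a′ ⊎ SameCycle π′ i b′

    touches-back : ∀ {i j} → SameCycle π′ i j → Touches j → Touches i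
    touches-back ij (inj₁ ja) = inj₁ (SameCycle-trans π′ ij ja)
    touches-back ij (inj₂ jb) = inj₂ (SameCycle-trans π′ ij jb)

    -- The finest coarsening of SameCycle π′ in which a′ and b′ are equivalent.
    Joined : Fin n → Fin n → Set
    Joined i j = SameCycle π′ i j ⊎ Touches i × Touches j

    joined-trans : Transitive Joined
    joined-trans (inj₁ ij)        (inj₁ jk)        = inj₁ (SameCycle-trans π′ ij jk)
    joined-trans (inj₁ ij)        (inj₂ (tj , tk)) = inj₂ (touches-back ij tj , tk)
    joined-trans (inj₂ (ti , tj)) (inj₁ jk)        = inj₂ (ti , touches-back (SameCycle-sym π′ jk) tj)
    joined-trans (inj₂ (ti , _))  (inj₂ (_ , tk))  = inj₂ (ti , tk)

    image-touches : ∀ {c c′} → c′ ≡ γ ⟨$⟩ˡ c → Touches c′ → Touches (π ⟨$⟩ʳ c)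
    image-touches {c} refl = touches-back
      (subst (λ x → SameCycle π′ (π ⟨$⟩ʳ x) _) (inverseʳ γ) (SameCycle-step⁻ π′ _))

    -- The maps `π′` and `ρ′` can differ only at `a′` and `b′`, where `ρ′` takes the value of `π′`
    -- at the other of the two points.
    joined-step : ∀ i → Joined i (ρ′ ⟨$⟩ʳ i)
    joined-step i with γ ⟨$⟩ʳ i Fin.≟ a
    ... | yes refl = inj₂ ( inj₁ (0 , sym (inverseˡ γ))
                          , image-touches refl (inj₂ (SameCycle-refl π′)))
    ... | no _ with γ ⟨$⟩ʳ i Fin.≟ b
    ...   | yes refl = inj₂ ( inj₂ (0 , sym (inverseˡ γ))
                            , image-touches refl (inj₁ (SameCycle-refl π′)))
    ...   | no _     = inj₁ (SameCycle-step π′ i)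

    SameCycle⇒joined : ∀ {i j} → SameCycle ρ′ i j → Joined i j
    SameCycle⇒joined {i} (k , refl) = go k
      where
      go : ∀ k → Joined i (fold i (ρ′ ⟨$⟩ʳ_) k)
      go zero    = inj₁ (SameCycle-refl π′)
      go (suc k) = joined-trans (go k) (joined-step _)

    -- Outside the cycle of `a′`, touching means lying on the cycle of `b′`, so joining the two
    -- cycles identifies nothing new there.
    joined⇒SameCycle : ∀ {i j} → ¬ SameCycle π′ a′ i → ¬ SameCycle π′ a′ j →
                       Joined i j → SameCycle π′ i j
    joined⇒SameCycle ¬ai ¬aj (inj₁ ij)                  = ij
    joined⇒SameCycle ¬ai ¬aj (inj₂ (inj₁ ia , _))       = contradiction (SameCycle-sym π′ ia) ¬ai
    joined⇒SameCycle ¬ai ¬aj (inj₂ (_ , inj₁ ja))       = contradiction (SameCycle-sym π′ ja) ¬aj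
    joined⇒SameCycle ¬ai ¬aj (inj₂ (inj₂ ib , inj₂ jb)) = SameCycle-trans π′ ib (SameCycle-sym π′ jb)

    apart : ∀ {xs} → All (λ i → ¬ SameCycle π′ a′ i) xs → AllPairs (λ i j → ¬ SameCycle π′ i j) xs →
            AllPairs (λ i j → ¬ SameCycle ρ′ i j) xs
    apart []          []         = []
    apart (¬ai ∷ ¬as) (¬r ∷ ¬rs) =
      All.zipWith (λ (¬aj , ¬ij) → ¬ij ∘ joined⇒SameCycle ¬ai ¬aj ∘ SameCycle⇒joined) (¬as , ¬r)
      ∷ apart ¬as ¬rs

  -- Removing the representative of the cycle of `a′` costs one; the remaining ones lie on different
  -- cycles of `ρ′` too, so there are at most `C ρ′` of them.
  C≤1+C-transpose : C π′ ≤ suc (C ρ′)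
  C≤1+C-transpose = ℕ.≤-trans
    (length≤1+filter (SameCycle-sym π′) (SameCycle-trans π′) (SameCycle? π′) a′
       (representatives-apart π′))
    (s≤s (apart⇒length≤ (SameCycle-sym ρ′) (SameCycle-trans ρ′)
       (apart (All.all-filter (¬? ∘ SameCycle? π′ a′) (representatives π′))
              (AllPairs.filter⁺ (¬? ∘ SameCycle? π′ a′) (representatives-apart π′)))
       (representatives-cover ρ′)))

∣-∣≤1 : ∀ {k l} → k ≤ suc l → l ≤ suc k → ∣ k - l ∣ ≤ 1
∣-∣≤1 {zero}  {l}     _         l≤1       = l≤1
∣-∣≤1 {suc k} {zero}  k≤1       _         = k≤1
∣-∣≤1 {suc k} {suc l} (s≤s k≤l) (s≤s l≤k) = ∣-∣≤1 k≤l l≤k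

C-transpose : (π γ : Permutation′ n) (a b : Fin n) →
              ∣ C (π · γ) - C (π · transpose a b · γ) ∣ ≤ 1
C-transpose π γ a b = ∣-∣≤1 (C≤1+C-transpose π γ a b)
  -- The reverse inequality is the same lemma for `π · τ`, because `τ` is an involution.
  (subst (λ k → C (π · τ · γ) ≤ suc k)
     (C-cong {π = π · τ · τ · γ} {π · γ} (λ i → cong (π ⟨$⟩ʳ_) (transpose-involutive a b (γ ⟨$⟩ʳ i))))
     (C≤1+C-transpose (π · τ) γ a b))
  where τ = transpose a b

-- Edges

Edges : ℕ → Set
Edges n = List (Fin n × Fin n)

private
  variable
    es es₁ es₂ es₃ : Edges n

-- Distinct sources ensure that redirecting two of the edges leaves all others intact.
Realises : Permutation′ n → Edges n → Set
Realises π es = All (λ (x , y) → π ⟨$⟩ʳ x ≡ y) es × Unique (map proj₁ es)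

infix 4 _⇒[_]_

-- A record so that rewriting the edge lists does not unfold it.
record _⇒[_]_ {n} (es₁ : Edges n) (k : ℕ) (es₂ : Edges n) : Set where
  field
    transport : ∀ π → Realises π es₁ →
      ∃ λ ρ → Realises ρ es₂ × ∀ σ γ → ∣ C (σ · π · γ) - C (σ · ρ · γ) ∣ ≤ k

open _⇒[_]_

⇒-trans : ∀ {k l} → es₁ ⇒[ k ] es₂ → es₂ ⇒[ l ] es₃ → es₁ ⇒[ k + l ] es₃
⇒-trans p q .transport π πr =
  let ρ , ρr , πρ = transport p π πr
      τ , τr , ρτ = transport q ρ ρr
  in τ , τr , λ σ γ → ℕ.≤-trans
       (ℕ.∣-∣-triangle (C (σ · π · γ)) (C (σ · ρ · γ)) (C (σ · τ · γ)))
       (ℕ.+-mono-≤ (πρ σ γ) (ρτ σ γ))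

Unique-resp-↭ : {xs ys : List A} → xs ↭ ys → Unique xs → Unique ys
Unique-resp-↭ xs↭ys = Permutationₛ.Unique-resp-↭ (setoid _) (↭⇒↭ₛ xs↭ys)

↭⇒⇒ : es₁ ↭ es₂ → es₁ ⇒[ 0 ] es₂
↭⇒⇒ es₁↭es₂ .transport π (all , unique) = π
  , (All-resp-↭ es₁↭es₂ all , Unique-resp-↭ (↭-map⁺ proj₁ es₁↭es₂) unique)
  , λ σ γ → ℕ.≤-reflexive (ℕ.∣n-n∣≡0 (C (σ · π · γ)))

-- Precomposing with the transposition of the sources `a` and `c` swaps their images. The list of
-- sources does not change, so its uniqueness carries over.
exchange-targets : ∀ {a b c d : Fin n} →
                   (a , b) ∷ (c , d) ∷ es ⇒[ 1 ] (a , d) ∷ (c , b) ∷ es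
exchange-targets {a = a} {c = c} .transport π (πa ∷ πc ∷ all , unique@((_ ∷ a∉) ∷ c∉ ∷ _)) =
  π · transpose a c
  , ( trans (cong (π ⟨$⟩ʳ_) (transpose-first a c)) πc
    ∷ trans (cong (π ⟨$⟩ʳ_) (transpose-second a c)) πa
    ∷ All.map (λ (a≢x , c≢x , πx) → trans (cong (π ⟨$⟩ʳ_) (transpose-other a≢x c≢x)) πx)
        (All.zip (All.map⁻ a∉ , All.zip (All.map⁻ c∉ , all)))
    , unique)
  , λ σ γ → C-transpose (σ · π) γ a c

-- The consecutive pairs of the sequence x, xs, 0; a block xs contributes
-- path x xs, preceded by the edge into its first entry.

first : List (Fin n) → Fin (suc n)
first []      = zero
first (y ∷ _) = suc y

last : Fin (suc n) → List (Fin n) → Fin (suc n)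
last x []       = x
last x (y ∷ ys) = last (suc y) ys

path : Fin (suc n) → List (Fin n) → Edges (suc n)
path x []       = []
path x (y ∷ ys) = (x , suc y) ∷ path (suc y) ys

-- Kept apart from `loop` so that the edge leaving a cut is exposed whether or not entries follow;
-- after the last entry it is the closing edge to `zero`.
tail-loop : List (Fin n) → Edges (suc n)
tail-loop []       = []
tail-loop (y ∷ ys) = (suc y , first ys) ∷ tail-loop ys

loop : Fin (suc n) → List (Fin n) → Edges (suc n)
loop x xs = (x , first xs) ∷ tail-loop xs

loop-++ : ∀ x (xs ys : List (Fin n)) → loop x (xs ++ ys) ≡ path x xs ++ loop (last x xs) ys
loop-++ x []       ys = refl
loop-++ x (z ∷ xs) ys = cong ((x , suc z) ∷_) (loop-++ (suc z) xs ys)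

loop-sources : ∀ x (xs : List (Fin n)) → map proj₁ (loop x xs) ≡ x ∷ map suc xs
loop-sources x []       = refl
loop-sources x (y ∷ ys) = cong (x ∷_) (loop-sources (suc y) ys)

-- Block-interchanges on edge lists

module _ {n : ℕ} where
  open CommutativeMonoidSolver (++-commutativeMonoid {A = Fin n × Fin n}) public
    using (solve; _⊜_; _⊕_)

-- With p, α, μ, β the entries before the four cuts, the targets of p and μ are
-- exchanged first, then those of α and β.  The order of the two exchanges
-- matters when the middle block is empty, since then μ = α.
interchange-adjacent : ∀ pre (a : Fin n) as b bs post →
  loop zero (pre ++ (a ∷ as) ++ (b ∷ bs) ++ post) ⇒[ 2 ]
  loop zero (pre ++ (b ∷ bs) ++ (a ∷ as) ++ post)
interchange-adjacent pre a as b bs post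
  rewrite loop-++ zero pre ((a ∷ as) ++ (b ∷ bs) ++ post)
        | loop-++ (suc a) as ((b ∷ bs) ++ post)
        | loop-++ (suc b) bs post
        | loop-++ zero pre ((b ∷ bs) ++ (a ∷ as) ++ post)
        | loop-++ (suc b) bs ((a ∷ as) ++ post)
        | loop-++ (suc a) as post
  = ⇒-trans (↭⇒⇒ (solve 7 (λ P pa A αb B βq Q →
      P ⊕ pa ⊕ A ⊕ αb ⊕ B ⊕ βq ⊕ Q ⊜ pa ⊕ αb ⊕ βq ⊕ P ⊕ A ⊕ B ⊕ Q) ↭-refl
      (path zero pre) [ p , suc a ] (path (suc a) as) [ α , suc b ] (path (suc b) bs)
      [ β , first post ] (tail-loop post)))
   -- This exchange closes `a ∷ as` up into a cycle of its own, which the second one inserts again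
   -- behind `β`.
   (⇒-trans exchange-targets
   (⇒-trans (↭⇒⇒ (solve 4 (λ pb αa βq R → pb ⊕ αa ⊕ βq ⊕ R ⊜ αa ⊕ βq ⊕ pb ⊕ R) ↭-refl
      [ p , suc b ] [ α , suc a ] [ β , first post ] _))
   (⇒-trans exchange-targets
   (↭⇒⇒ (solve 7 (λ P pb B βa A αq Q →
      αq ⊕ βa ⊕ pb ⊕ P ⊕ A ⊕ B ⊕ Q ⊜ P ⊕ pb ⊕ B ⊕ βa ⊕ A ⊕ αq ⊕ Q) ↭-refl
      (path zero pre) [ p , suc b ] (path (suc b) bs) [ β , suc a ] (path (suc a) as)
      [ α , first post ] (tail-loop post))))))
  where
  p = last zero pre
  α = last (suc a) as
  β = last (suc b) bs

interchange-separated : ∀ pre (a : Fin n) as m ms b bs post →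
  loop zero (pre ++ (a ∷ as) ++ (m ∷ ms) ++ (b ∷ bs) ++ post) ⇒[ 2 ]
  loop zero (pre ++ (b ∷ bs) ++ (m ∷ ms) ++ (a ∷ as) ++ post)
interchange-separated pre a as m ms b bs post
  rewrite loop-++ zero pre ((a ∷ as) ++ (m ∷ ms) ++ (b ∷ bs) ++ post)
        | loop-++ (suc a) as ((m ∷ ms) ++ (b ∷ bs) ++ post)
        | loop-++ (suc m) ms ((b ∷ bs) ++ post)
        | loop-++ (suc b) bs post
        | loop-++ zero pre ((b ∷ bs) ++ (m ∷ ms) ++ (a ∷ as) ++ post)
        | loop-++ (suc b) bs ((m ∷ ms) ++ (a ∷ as) ++ post)
        | loop-++ (suc m) ms ((a ∷ as) ++ post)
        | loop-++ (suc a) as post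
  = ⇒-trans (↭⇒⇒ (solve 9 (λ P pa A αm M μb B βq Q →
      P ⊕ pa ⊕ A ⊕ αm ⊕ M ⊕ μb ⊕ B ⊕ βq ⊕ Q ⊜ pa ⊕ μb ⊕ αm ⊕ βq ⊕ P ⊕ A ⊕ M ⊕ B ⊕ Q) ↭-refl
      (path zero pre) [ p , suc a ] (path (suc a) as) [ α , suc m ] (path (suc m) ms)
      [ μ , suc b ] (path (suc b) bs) [ β , first post ] (tail-loop post)))
   -- This exchange splits off `a ∷ as` and `m ∷ ms` together as one cycle. The second one opens it
   -- between `α` and `m` and inserts it behind `β`, so that `m ∷ ms` comes first.
   (⇒-trans exchange-targets
   (⇒-trans (↭⇒⇒ (solve 5 (λ pb μa αm βq R → pb ⊕ μa ⊕ αm ⊕ βq ⊕ R ⊜ αm ⊕ βq ⊕ pb ⊕ μa ⊕ R) ↭-refl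
      [ p , suc b ] [ μ , suc a ] [ α , suc m ] [ β , first post ] _))
   (⇒-trans exchange-targets
   (↭⇒⇒ (solve 9 (λ P pb B βm M μa A αq Q →
      αq ⊕ βm ⊕ pb ⊕ μa ⊕ P ⊕ A ⊕ M ⊕ B ⊕ Q ⊜ P ⊕ pb ⊕ B ⊕ βm ⊕ M ⊕ μa ⊕ A ⊕ αq ⊕ Q) ↭-refl
      (path zero pre) [ p , suc b ] (path (suc b) bs) [ β , suc m ] (path (suc m) ms)
      [ μ , suc a ] (path (suc a) as) [ α , first post ] (tail-loop post))))))
  where
  p = last zero pre
  α = last (suc a) as
  μ = last (suc m) ms
  β = last (suc b) bs

-- An empty middle block leaves three cut edges instead of four, hence the two cases.
interchange-edges : {xs ys : List (Fin n)} → BlockInterchange xs ys →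
                    loop zero xs ⇒[ 2 ] loop zero ys
interchange-edges (interchange pre a as []       b bs post) = interchange-adjacent pre a as b bs post
interchange-edges (interchange pre a as (m ∷ ms) b bs post) = interchange-separated pre a as m ms b bs post

interchanges-edges : ∀ {d} {xs ys : List (Fin n)} → xs ⟶[ d ] ys →
                     loop zero xs ⇒[ d * 2 ] loop zero ys
interchanges-edges done       = ↭⇒⇒ ↭-refl
interchanges-edges (step s r) = ⇒-trans (interchange-edges s) (interchanges-edges r)

-- The two ends of a sorting sequence

-- Brings a claim about edges into the form of `cycle-suc` and `cycle-last`. The starting point
-- `c zero` is arbitrary so that the induction can pass to `c ∘ suc`.
loop-tabulate : ∀ {m} {R : Fin (suc n) × Fin (suc n) → Set}
  (c : Fin (suc m) → Fin (suc n)) (g : Fin m → Fin n) → (∀ i → c (suc i) ≡ suc (g i)) →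
  (∀ i → R (c (inject₁ i) , c (suc i))) → R (c (fromℕ m) , zero) →
  All R (loop (c zero) (tabulate g))
loop-tabulate {m = zero}  c g c-suc r r-last = r-last ∷ []
loop-tabulate {m = suc m} {R} c g c-suc r r-last =
  subst (λ y → R (c zero , y)) (c-suc zero) (r zero)
  ∷ subst (λ y → All R (loop y (tabulate (g ∘ suc)))) (c-suc zero)
      (loop-tabulate (c ∘ suc) (g ∘ suc) (c-suc ∘ suc) (r ∘ suc) r-last)

bar-realises : (s : Permutation′ n) → Realises (bar s) (loop zero (oneLine s))
bar-realises s =
  loop-tabulate (lift₀ s ⟨$⟩ʳ_) (s ⟨$⟩ʳ_) (λ _ → refl) (cycle-suc (lift₀ s)) (cycle-last (lift₀ s))
  , subst Unique (sym (loop-sources zero (oneLine s)))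
      (All.map⁺ (All.universal (λ _ ()) (oneLine s))
      ∷ Unique.map⁺ Fin.suc-injective (Unique.tabulate⁺ (⟨$⟩ʳ-injective s)))

opposite-inject₁ : (i : Fin n) → opposite (inject₁ i) ≡ suc (opposite i)
opposite-inject₁ zero    = refl
opposite-inject₁ (suc i) = cong inject₁ (opposite-inject₁ i)

opposite-fromℕ : ∀ n → opposite (fromℕ n) ≡ zero
opposite-fromℕ zero    = refl
opposite-fromℕ (suc n) = cong inject₁ (opposite-fromℕ n)

-- The cycle lists the values of `opposite`: `suc i` stands at position `inject₁ (opposite i)`, and
-- `inject₁ i` at the next one.
pₜ-suc : (i : Fin n) → pₜ n ⟨$⟩ʳ suc i ≡ inject₁ i
pₜ-suc {n} i = trans (cong (pₜ n ⟨$⟩ʳ_) suc-i) (trans (cycle-suc reverse (opposite i))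
  (cong inject₁ (Fin.opposite-involutive i)))
  where
  suc-i : suc i ≡ opposite (inject₁ (opposite i))
  suc-i = sym (trans (opposite-inject₁ (opposite i)) (cong suc (Fin.opposite-involutive i)))

pₜ-zero : ∀ n → pₜ n ⟨$⟩ʳ zero ≡ fromℕ n
pₜ-zero n = trans (cong (pₜ n ⟨$⟩ʳ_) (sym (opposite-fromℕ n))) (cycle-last reverse)

-- `pₜ` runs through every edge of the sorted loop backwards, and the sources of these edges exhaust
-- `Fin (suc n)`.
pₜ-inverts : (ρ : Permutation′ (suc n)) → Realises ρ (loop zero (e n)) →
             ∀ i → pₜ n ⟨$⟩ʳ (ρ ⟨$⟩ʳ i) ≡ i
pₜ-inverts {n} ρ (all , _) = λ where
    zero    → All.head on-sources
    (suc i) → All.lookup (All.map⁻ (All.tail on-sources)) (∈-allFin i)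
  where
  pₜ-edges : All (λ (x , y) → pₜ n ⟨$⟩ʳ y ≡ x) (loop zero (e n))
  pₜ-edges = loop-tabulate (λ i → i) (λ i → i) (λ _ → refl) pₜ-suc (pₜ-zero n)

  on-sources : All (λ x → pₜ n ⟨$⟩ʳ (ρ ⟨$⟩ʳ x) ≡ x) (zero ∷ map suc (e n))
  on-sources = subst (All _) (loop-sources zero (e n))
    (All.map⁺ (All.zipWith (λ { (refl , eq) → eq }) (all , pₜ-edges)))

-- The lower bound

sorting-bound : ∀ {d} (s : Permutation′ n) → oneLine s ⟶[ d ] e n →
                ∀ γ → ∣ C (pₜ n · bar s · γ) - C γ ∣ ≤ d * 2
sorting-bound {n} {d} s r γ =
  let ρ , ρ-realises , bound = transport (interchanges-edges r) (bar s) (bar-realises s)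
  in subst (λ k → ∣ C (pₜ n · bar s · γ) - k ∣ ≤ d * 2)
       (C-cong {π = pₜ n · ρ · γ} {γ} (λ i → pₜ-inverts ρ ρ-realises (γ ⟨$⟩ʳ i)))
       (bound (pₜ n) γ)

≤*2⇒/2≤/1 : ∀ m d → m ≤ d * 2 → (+ d) / 1 ≥ (+ m) / 2
≤*2⇒/2≤/1 m d m≤d*2 = ℚ.toℚᵘ-cancel-≤ (begin
  -- Unnormalised fractions compare by cross-multiplication; `mkℚᵘ` takes the denominator minus one.
  ℚ.toℚᵘ ((+ m) / 2)  ≃⟨ ℚ.toℚᵘ-fromℚᵘ (ℚᵘ.mkℚᵘ (+ m) 1) ⟩
  ℚᵘ.mkℚᵘ (+ m) 1     ≤⟨ ℚᵘ.*≤* (subst₂ ℤ._≤_ (ℤ.pos-* m 1) (ℤ.pos-* d 2)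
                          (ℤ.+≤+ (subst (_≤ d * 2) (sym (ℕ.*-identityʳ m)) m≤d*2))) ⟩
  ℚᵘ.mkℚᵘ (+ d) 0     ≃⟨ ℚ.toℚᵘ-fromℚᵘ (ℚᵘ.mkℚᵘ (+ d) 0) ⟨
  ℚ.toℚᵘ ((+ d) / 1)  ∎)
  where open ℚᵘ.≤-Reasoning

mainTheorem4 : (n : ℕ) → 1 ≤ n → (s : Permutation′ n) →
    (+ bid s) / 1 ≥ (+ maxₚ (λ γ → ∣ C (pₜ n · bar s · γ) - C γ ∣)) / 2
-- `z≤n` covers the bottom value `0` of the maximum; a sorting sequence of length `bid s` bounds
-- every other entry.
mainTheorem4 n _ s = ≤*2⇒/2≤/1 _ (bid s) (max≤v⁺ z≤n (All.map⁺ (All.universal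
  (sorting-bound s (proj₁ (proj₂ (bid-least s)))) (permutations (suc n)))))
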